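{- Let $q$ be a prime power, let $\mathcal{A}\subseteq\mathbb{F}_q^{3\times4}$ be a set of $q^8$ matrices with $\operatorname{rank}(\mathbf{A}-\mathbf{B})\geq2$ for all distinct $\mathbf{A},\mathbf{B}\in\mathcal{A}$, and let $\mathcal{L}=\{\langle(\mathbf{I}_3|\mathbf{A})\rangle:\mathbf{A}\in\mathcal{A}\}$, where $\langle\mathbf{M}\rangle$ denotes the row space in $\mathbb{F}_q^7$. Then there is a set $\mathcal{E}$ of $q^4+q^3+2q^2+q+1$ further $3$-dimensional subspaces of $\mathbb{F}_q^7$ such that $\mathcal{C}=\mathcal{L}\cup\mathcal{E}$ is a plane subspace code of size $q^8+q^4+q^3+2q^2+q+1$.
   Context: A plane subspace code in $\mathbb{F}_q^7$ is a set of $3$-dimensional subspaces of $\mathbb{F}_q^7$ any two distinct members of which intersect in a subspace of dimension at most $1$. The set $\mathcal{L}$ is called a plane LMRD (lifted maximum rank distance) code. -}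

module Defs where

open import Level using (_⊔_)
open import Data.Nat using (ℕ; zero; suc; _^_)
open import Data.Nat.Primality using (Prime)
open import Data.Fin using (Fin; splitAt)
import Data.Fin as F
open import Data.Sum using (inj₁; inj₂)
open import Data.Product using (Σ; ∃; ∃₂; _×_)
open import Relation.Nullary using (¬_)
open import Relation.Binary.PropositionalEquality using (_≡_)
open import Algebra.Bundles using (CommutativeRing)

IsPrimePower : ℕ → Set
IsPrimePower q = ∃₂ λ p k → Prime p × q ≡ p ^ suc k

module Lin {c ℓ} (R : CommutativeRing c ℓ) where
  open CommutativeRing R

  record IsField : Set (c ⊔ ℓ) where
    field
      nontrivial : ¬ (0# ≈ 1#)
      inverse    : ∀ x → ¬ (x ≈ 0#) → ∃ λ y → x * y ≈ 1#

  Vect : ℕ → Set c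
  Vect n = Fin n → Carrier

  Mat : ℕ → ℕ → Set c
  Mat m n = Fin m → Fin n → Carrier

  sumF : ∀ {n} → (Fin n → Carrier) → Carrier
  sumF {zero}  f = 0#
  sumF {suc n} f = f F.zero + sumF (λ i → f (F.suc i))

  lincomb : ∀ {m n} → Vect m → Mat m n → Vect n
  lincomb cs M j = sumF (λ i → cs i * M i j)

  _-ᴹ_ : ∀ {m n} → Mat m n → Mat m n → Mat m n
  (A -ᴹ B) i j = A i j + (- B i j)

  LinIndep : ∀ {m n} → Mat m n → Set (c ⊔ ℓ)
  LinIndep {m} M = ∀ (cs : Vect m) → (∀ j → lincomb cs M j ≈ 0#) → ∀ i → cs i ≈ 0#

  RankAtLeast : ∀ {m n} → ℕ → Mat m n → Set (c ⊔ ℓ)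
  RankAtLeast {m} k M = Σ (Fin k → Fin m) λ σ → LinIndep (λ i → M (σ i))

  _∈⟨_⟩ : ∀ {m n} → Vect n → Mat m n → Set (c ⊔ ℓ)
  _∈⟨_⟩ {m} v M = Σ (Vect m) λ cs → ∀ j → v j ≈ lincomb cs M j

  SameSpace : ∀ {m m' n} → Mat m n → Mat m' n → Set (c ⊔ ℓ)
  SameSpace {n = n} M N = (∀ (v : Vect n) → v ∈⟨ M ⟩ → v ∈⟨ N ⟩)
                        × (∀ (v : Vect n) → v ∈⟨ N ⟩ → v ∈⟨ M ⟩)

  IntersectDimAtMost1 : ∀ {m m' n} → Mat m n → Mat m' n → Set (c ⊔ ℓ)
  IntersectDimAtMost1 {n = n} M N =
    ∀ (V : Mat 2 n) → (∀ i → V i ∈⟨ M ⟩ × V i ∈⟨ N ⟩) → ¬ LinIndep V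

  lift : Mat 3 4 → Mat 3 7
  lift A i j with splitAt 3 j
  ... | inj₁ k = if-eq i k
    where
      if-eq : Fin 3 → Fin 3 → Carrier
      if-eq a b with a F.≟ b
      ... | Relation.Nullary.yes _ = 1#
      ... | Relation.Nullary.no  _ = 0#
  ... | inj₂ k = A i k

  -- a family of 3-dimensional subspaces of F^7, each given by a 3×7
  -- generator matrix of rank 3, which (as a set of subspaces, i.e. with
  -- distinct indices giving distinct subspaces) is a plane subspace code
  IsPlaneCodeFamily : ∀ {N} → (Fin N → Mat 3 7) → Set (c ⊔ ℓ)
  IsPlaneCodeFamily {N} C =
      (∀ i → LinIndep (C i))
    × (∀ i j → ¬ (i ≡ j) → ¬ SameSpace (C i) (C j))
    × (∀ i j → ¬ SameSpace (C i) (C j) → IntersectDimAtMost1 (C i) (C j))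

-- Let S be the solid 0³ × F⁴, which every lifted plane meets trivially.  To each of
-- the q⁴ + q³ + 2q² + q + 1 lines ℓ of S attach one plane E = ⟨ℓ, (p ∣ s)⟩ with
-- p ∈ F³ nonzero.  As E meets S in a line, it shares at most a point with a lifted
-- plane.  Two such planes with different ⟨p⟩ meet inside S, hence in at most a point;
-- so do two with the same p if s − s′ ∉ ℓ + ℓ′ or ℓ ∩ ℓ′ = 0.
-- With ℓ₀ the coordinate line {x₁ = x₂ = 0} of S, the pairs (p, s) are chosen as follows.
--  * The q⁴ lines skew to ℓ₀ are the row spaces of (I₂ ∣ M) with M = (x y ; z x+d).
--    They get p = (1, y, d) and s = (0, 0, 0, z): for equal p, the difference of the
--    3×2 matrices (M ; 0 z) has the form (a 0 ; b a ; 0 b), of rank 2 unless zero.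
--  * The lines ≠ ℓ₀ meeting ℓ₀ are indexed by their point Pᵢ on ℓ₀, their plane
--    through ℓ₀ (the point Pⱼ of S/ℓ₀) and a scalar k.  They get p = (0, Pᵢ₊ⱼ), where
--    the index i + j is taken modulo q + 1 (a Latin square), so for equal p the
--    pairs (i, j) agree or differ in both entries; if they agree, s separates the k.
--  * ℓ₀ itself gets p = (1, 0, 0) and s = 0.
module Submission where

open import Defs
open import Level using (_⊔_)
open import Data.Nat using (ℕ; suc)
open import Data.Nat.DivMod using (_%_; m%n<n; m%n%n≡m%n; %-distribˡ-+; [m+n]%n≡m%n; m<n⇒m%n≡m)
open import Data.Fin using (Fin; zero; suc; toℕ; fromℕ<; splitAt; _↑ˡ_; _↑ʳ_)
open import Data.Fin.Patterns using (0F; 1F; 2F; 3F; 4F; 5F; 6F)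
open import Data.Fin.Properties using (_≟_; toℕ<n; toℕ-injective; toℕ-fromℕ<; +↔⊎; *↔×)
open import Data.Product using (Σ; ∃; _×_; _,_; proj₁; proj₂)
open import Data.Product.Function.NonDependent.Propositional using (_×-↔_)
open import Data.Sum using (_⊎_; inj₁; inj₂)
open import Data.Sum.Function.Propositional using (_⊎-↔_)
open import Data.Empty using (⊥-elim)
open import Data.Vec.Functional using (_++_; _∷_; [])
open import Relation.Nullary using (¬_; Dec; yes; no)
open import Relation.Binary.Definitions using (Symmetric)
open import Relation.Binary.PropositionalEquality as ≡ using (_≡_; _≢_; setoid)
open import Function using (_∘_)
open import Function.Bundles using (Injection; Inverse; _↔_)
open import Function.Properties.Inverse using (↔-refl; ↔-trans; Inverse⇒Injection)
open import Function.Related.Propositional using (≡⇒)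
open import Algebra.Bundles using (CommutativeRing)
import Data.Nat as ℕ
import Data.Nat.Properties as ℕ
import Data.Nat.Solver as ℕ-Solver

-- A cyclic Latin square.

module CyclicSum (n : ℕ) where

  infixl 6 _⊕_
  _⊕_ : Fin (suc n) → Fin (suc n) → Fin (suc n)
  i ⊕ j = fromℕ< (m%n<n (toℕ i ℕ.+ toℕ j) (suc n))

  ⊕-comm : ∀ i j → i ⊕ j ≡ j ⊕ i
  ⊕-comm i j = toℕ-injective (begin
    toℕ (i ⊕ j)                  ≡⟨ toℕ-fromℕ< _ ⟩
    (toℕ i ℕ.+ toℕ j) % suc n    ≡⟨ ≡.cong (_% suc n) (ℕ.+-comm (toℕ i) (toℕ j)) ⟩
    (toℕ j ℕ.+ toℕ i) % suc n    ≡⟨ toℕ-fromℕ< _ ⟨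
    toℕ (j ⊕ i)                  ∎)
    where open ≡.≡-Reasoning

  -- Adding the complement of `i` modulo `suc n` undoes `i ⊕_`. Together with `⊕-cancelʳ` this makes
  -- the table of `⊕` a Latin square.
  ⊕-cancelˡ : ∀ i {j k} → i ⊕ j ≡ i ⊕ k → j ≡ k
  ⊕-cancelˡ i {j} {k} eq = toℕ-injective (≡.trans (≡.sym (undo j)) (≡.trans (≡.cong shift eq) (undo k)))
    where
    open ≡.≡-Reasoning
    N = suc n
    -- A representative of -i modulo `N`; the truncated subtraction is exact because i < N.
    c = N ℕ.∸ toℕ i

    shift : Fin N → ℕ
    shift l = (toℕ l ℕ.+ c) % N

    undo : ∀ l → shift (i ⊕ l) ≡ toℕ l
    undo l = begin
      (toℕ (i ⊕ l) ℕ.+ c) % N                       ≡⟨ ≡.cong (λ m → (m ℕ.+ c) % N) (toℕ-fromℕ< (m%n<n (toℕ i ℕ.+ toℕ l) N)) ⟩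
      ((toℕ i ℕ.+ toℕ l) % N ℕ.+ c) % N             ≡⟨ %-distribˡ-+ ((toℕ i ℕ.+ toℕ l) % N) c N ⟩
      ((toℕ i ℕ.+ toℕ l) % N % N ℕ.+ c % N) % N     ≡⟨ ≡.cong (λ m → (m ℕ.+ c % N) % N) (m%n%n≡m%n (toℕ i ℕ.+ toℕ l) N) ⟩
      ((toℕ i ℕ.+ toℕ l) % N ℕ.+ c % N) % N         ≡⟨ %-distribˡ-+ (toℕ i ℕ.+ toℕ l) c N ⟨
      (toℕ i ℕ.+ toℕ l ℕ.+ c) % N                   ≡⟨ ≡.cong (λ m → (m ℕ.+ c) % N) (ℕ.+-comm (toℕ i) (toℕ l)) ⟩
      (toℕ l ℕ.+ toℕ i ℕ.+ c) % N                   ≡⟨ ≡.cong (_% N) (ℕ.+-assoc (toℕ l) (toℕ i) c) ⟩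
      (toℕ l ℕ.+ (toℕ i ℕ.+ c)) % N                 ≡⟨ ≡.cong (λ m → (toℕ l ℕ.+ m) % N) (ℕ.m+[n∸m]≡n (ℕ.<⇒≤ (toℕ<n i))) ⟩
      (toℕ l ℕ.+ N) % N                             ≡⟨ [m+n]%n≡m%n (toℕ l) N ⟩
      toℕ l % N                                     ≡⟨ m<n⇒m%n≡m (toℕ<n l) ⟩
      toℕ l                                         ∎

  ⊕-cancelʳ : ∀ j {i k} → i ⊕ j ≡ k ⊕ j → i ≡ k
  ⊕-cancelʳ j {i} {k} eq = ⊕-cancelˡ j (≡.trans (⊕-comm j i) (≡.trans eq (⊕-comm k j)))

-- Properties of concatenated families.

++-all : ∀ {a p} {A : Set a} (P : A → Set p) {m n} (xs : Fin m → A) (ys : Fin n → A) →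
  (∀ i → P (xs i)) → (∀ i → P (ys i)) → ∀ i → P ((xs ++ ys) i)
++-all P {m} xs ys pxs pys i with splitAt m i
... | inj₁ a = pxs a
... | inj₂ b = pys b

-- Symmetry lets one mixed hypothesis serve both orders of the blocks. Within a block, injectivity
-- of `splitAt` turns distinct positions into distinct block indices.
++-pairwise : ∀ {a r} {A : Set a} (_~_ : A → A → Set r) → Symmetric _~_ →
  ∀ {m n} (xs : Fin m → A) (ys : Fin n → A) →
  (∀ i j → i ≢ j → xs i ~ xs j) → (∀ i j → xs i ~ ys j) → (∀ i j → i ≢ j → ys i ~ ys j) →
  ∀ i j → i ≢ j → (xs ++ ys) i ~ (xs ++ ys) j
++-pairwise _~_ ~-sym {m} {n} xs ys xx xy yy i j i≢j with splitAt m i in eqᵢ | splitAt m j in eqⱼ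
... | inj₁ a | inj₂ b = xy a b
... | inj₂ a | inj₁ b = ~-sym (xy b a)
... | inj₁ a | inj₁ b = xx a b λ { ≡.refl → i≢j (splitAt-injective (≡.trans eqᵢ (≡.sym eqⱼ))) }
  where splitAt-injective = Injection.injective (Inverse⇒Injection (+↔⊎ {m} {n}))
... | inj₂ a | inj₂ b = yy a b λ { ≡.refl → i≢j (splitAt-injective (≡.trans eqᵢ (≡.sym eqⱼ))) }
  where splitAt-injective = Injection.injective (Inverse⇒Injection (+↔⊎ {m} {n}))

-- Linear algebra over a field and a criterion for small intersections.

module Subspaces {c ℓ} (R : CommutativeRing c ℓ) (isField : Lin.IsField R) where
  open CommutativeRing R hiding (zero)
  open Lin R
  open IsField isField
  open import Algebra.Properties.Ring ring
  open import Algebra.Solver.Ring.NaturalCoefficients.Default commutativeSemiring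
    using (solve; _:=_; _:+_; _:*_; con)
  open import Relation.Binary.Reasoning.Setoid (CommutativeRing.setoid R)

  *-zero-cancelˡ : ∀ {x y} → ¬ x ≈ 0# → x * y ≈ 0# → y ≈ 0#
  *-zero-cancelˡ {x} {y} x≉0 xy≈0 with inverse x x≉0
  ... | x⁻¹ , xx⁻¹≈1 = begin
    y               ≈⟨ *-identityˡ y ⟨
    1# * y          ≈⟨ *-congʳ xx⁻¹≈1 ⟨
    x * x⁻¹ * y     ≈⟨ solve 3 (λ x x⁻¹ y → x :* x⁻¹ :* y := x⁻¹ :* (x :* y)) refl x x⁻¹ y ⟩
    x⁻¹ * (x * y)   ≈⟨ *-congˡ xy≈0 ⟩
    x⁻¹ * 0#        ≈⟨ zeroʳ x⁻¹ ⟩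
    0#              ∎

  -- The form in which field cancellation enters the comparison of planes: a shared coefficient that
  -- multiplies two different parameters must vanish.
  scalar-zero : ∀ {a x y} → ¬ x ≈ y → a * x ≈ a * y → a ≈ 0#
  scalar-zero {a} {x} {y} x≉y ax≈ay =
    *-zero-cancelˡ (λ x-y≈0 → x≉y (x∙y⁻¹≈ε⇒x≈y x y x-y≈0)) (begin
      (x - y) * a         ≈⟨ *-comm (x - y) a ⟩
      a * (x - y)         ≈⟨ x[y-z]≈xy-xz a x y ⟩
      a * x - a * y       ≈⟨ x≈y⇒x∙y⁻¹≈ε ax≈ay ⟩
      0#                  ∎)

  *-zeroˡ : ∀ {x y} → x ≈ 0# → x * y ≈ 0#
  *-zeroˡ {y = y} x≈0 = trans (*-congʳ x≈0) (zeroˡ y)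

  sumF-cong : ∀ {n} {f g : Fin n → Carrier} → (∀ i → f i ≈ g i) → sumF f ≈ sumF g
  sumF-cong {ℕ.zero} f≈g = refl
  sumF-cong {suc n} f≈g = +-cong (f≈g zero) (sumF-cong (f≈g ∘ suc))

  sumF-zero : ∀ {n} {f : Fin n → Carrier} → (∀ i → f i ≈ 0#) → sumF f ≈ 0#
  sumF-zero {ℕ.zero} f≈0 = refl
  sumF-zero {suc n} f≈0 = trans (+-cong (f≈0 zero) (sumF-zero (f≈0 ∘ suc))) (+-identityˡ 0#)

  sumF-linear : ∀ {n} a b (f g : Fin n → Carrier) →
    sumF (λ i → a * f i + b * g i) ≈ a * sumF f + b * sumF g
  sumF-linear {ℕ.zero} a b f g = solve 2 (λ a b → con 0 := a :* con 0 :+ b :* con 0) refl a b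
  sumF-linear {suc n} a b f g = trans (+-congˡ (sumF-linear a b (f ∘ suc) (g ∘ suc)))
    (solve 6 (λ a b x y s t → (a :* x :+ b :* y) :+ (a :* s :+ b :* t) := a :* (x :+ s) :+ b :* (y :+ t))
      refl a b (f zero) (g zero) (sumF (f ∘ suc)) (sumF (g ∘ suc)))

  lincomb-zero : ∀ {m n} {cs : Vect m} (M : Mat m n) → (∀ i → cs i ≈ 0#) → ∀ j → lincomb cs M j ≈ 0#
  lincomb-zero M cs≈0 j = sumF-zero (λ i → *-zeroˡ (cs≈0 i))

  lincomb-linear : ∀ {m n} a b (cs ds : Vect m) (M : Mat m n) j →
    lincomb (λ i → a * cs i + b * ds i) M j ≈ a * lincomb cs M j + b * lincomb ds M j
  lincomb-linear a b cs ds M j = trans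
    (sumF-cong λ i → solve 5 (λ a b x y m → (a :* x :+ b :* y) :* m := a :* (x :* m) :+ b :* (y :* m))
                       refl a b (cs i) (ds i) (M i j))
    (sumF-linear a b (λ i → cs i * M i j) (λ i → ds i * M i j))

  lincomb-unit : ∀ {n} (M : Mat 2 n) j → lincomb (1# ∷ 0# ∷ []) M j ≈ M 0F j
  lincomb-unit M j = solve 2 (λ x y → con 1 :* x :+ (con 0 :* y :+ con 0) := x) refl (M 0F j) (M 1F j)

  -- The coordinate functional v ↦ v k is injective on the intersection, so the
  -- combination (v₁ k) v₀ − (v₀ k) v₁ of two of its vectors vanishes.
  coordinate-criterion : ∀ {m m′ n} (M : Mat m n) (N : Mat m′ n) (k : Fin n) →
    (∀ cs ds → (∀ j → lincomb cs M j ≈ lincomb ds N j) → lincomb cs M k ≈ 0# → ∀ i → cs i ≈ 0#) →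
    IntersectDimAtMost1 M N
  coordinate-criterion M N k inj V V∈ indep =
    nontrivial (sym (indep (1# ∷ 0# ∷ []) (λ j → trans (lincomb-unit V j) (V₀≈0 j)) 0F))
    where
    cs ds : ∀ i → Vect _
    cs i = proj₁ (proj₁ (V∈ i))
    ds i = proj₁ (proj₂ (V∈ i))
    cs-eq : ∀ i j → V i j ≈ lincomb (cs i) M j
    cs-eq i = proj₂ (proj₁ (V∈ i))
    ds-eq : ∀ i j → V i j ≈ lincomb (ds i) N j
    ds-eq i = proj₂ (proj₂ (V∈ i))

    a b : Carrier
    a = V 1F k
    b = - V 0F k

    combination : ∀ {m} (M : Mat m _) (es : ∀ i → Vect m) → (∀ i j → V i j ≈ lincomb (es i) M j) →
      ∀ j → a * V 0F j + b * V 1F j ≈ lincomb (λ i → a * es 0F i + b * es 1F i) M j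
    combination M es eq j =
      trans (+-cong (*-congˡ (eq 0F j)) (*-congˡ (eq 1F j))) (sym (lincomb-linear a b (es 0F) (es 1F) M j))

    vanishes-at-k : a * V 0F k + b * V 1F k ≈ 0#
    vanishes-at-k = begin
      V 1F k * V 0F k + - V 0F k * V 1F k     ≈⟨ +-cong (*-comm _ _) (sym (-‿distribˡ-* _ _)) ⟩
      V 0F k * V 1F k - V 0F k * V 1F k       ≈⟨ -‿inverseʳ _ ⟩
      0#                                      ∎

    coefficients≈0 : ∀ i → a * cs 0F i + b * cs 1F i ≈ 0#
    coefficients≈0 = inj _ (λ i → a * ds 0F i + b * ds 1F i)
      (λ j → trans (sym (combination M cs cs-eq j)) (combination N ds ds-eq j))
      (trans (sym (combination M cs cs-eq k)) vanishes-at-k)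

    b≈0 : b ≈ 0#
    b≈0 = indep (a ∷ b ∷ []) (λ j → begin
      a * V 0F j + (b * V 1F j + 0#)  ≈⟨ +-congˡ (+-identityʳ _) ⟩
      a * V 0F j + b * V 1F j         ≈⟨ combination M cs cs-eq j ⟩
      lincomb _ M j                   ≈⟨ lincomb-zero M coefficients≈0 j ⟩
      0#                              ∎) 1F

    -- Independence has forced `b`, the negative of `V 0F k`, to be zero. So `V 0F` lies in the
    -- kernel of the functional, and a second use of `inj` makes it the zero vector, against
    -- independence.
    V₀k≈0 : V 0F k ≈ 0#
    V₀k≈0 = trans (sym (-‿involutive _)) (trans (-‿cong b≈0) -0#≈0#)

    V₀≈0 : ∀ j → V 0F j ≈ 0#
    V₀≈0 j = trans (cs-eq 0F j) (lincomb-zero M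
      (inj (cs 0F) (ds 0F) (λ j → trans (sym (cs-eq 0F j)) (ds-eq 0F j)) (trans (sym (cs-eq 0F k)) V₀k≈0)) j)

  IntersectDimAtMost1-sym : ∀ {m m′ n} (M : Mat m n) (N : Mat m′ n) →
    IntersectDimAtMost1 M N → IntersectDimAtMost1 N M
  IntersectDimAtMost1-sym _ _ dim≤1 V V∈ = dim≤1 V (λ i → proj₂ (V∈ i) , proj₁ (V∈ i))

  -- A bound on the intersections for distinct indices also gives distinct subspaces: if two spans
  -- agreed, the first two rows of one generator matrix would be an independent pair in both.
  -- Conversely, different subspaces have different indices because `SameSpace` is reflexive.
  planeCodeFamily : ∀ {N} (C : Fin N → Mat 3 7) → (∀ i → LinIndep (C i)) →
    (∀ i j → i ≢ j → IntersectDimAtMost1 (C i) (C j)) → IsPlaneCodeFamily C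
  planeCodeFamily C indep dim≤1 = indep , distinct , intersect
    where
    intersect : ∀ i j → ¬ SameSpace (C i) (C j) → IntersectDimAtMost1 (C i) (C j)
    intersect i j different with i ≟ j
    ... | yes ≡.refl = ⊥-elim (different ((λ _ v∈ → v∈) , (λ _ v∈ → v∈)))
    ... | no i≢j     = dim≤1 i j i≢j

    distinct : ∀ i j → i ≢ j → ¬ SameSpace (C i) (C j)
    distinct i j i≢j (⊆ , _) = dim≤1 i j i≢j V (λ l → V∈ l , ⊆ (V l) (V∈ l)) V-indep
      where
      V : Mat 2 7
      V 0F = C i 0F
      V 1F = C i 1F

      V∈ : ∀ l → V l ∈⟨ C i ⟩
      V∈ 0F = (1# ∷ 0# ∷ 0# ∷ []) , λ j →
        solve 3 (λ x y z → x := con 1 :* x :+ (con 0 :* y :+ (con 0 :* z :+ con 0))) refl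
          (C i 0F j) (C i 1F j) (C i 2F j)
      V∈ 1F = (0# ∷ 1# ∷ 0# ∷ []) , λ j →
        solve 3 (λ x y z → y := con 0 :* x :+ (con 1 :* y :+ (con 0 :* z :+ con 0))) refl
          (C i 0F j) (C i 1F j) (C i 2F j)

      V-indep : LinIndep V
      V-indep cs eq = λ { 0F → cs≈0 0F ; 1F → cs≈0 1F }
        where
        cs≈0 : ∀ l → (cs 0F ∷ cs 1F ∷ 0# ∷ []) l ≈ 0#
        cs≈0 = indep i _ (λ j → trans
          (solve 3 (λ x y z → x :+ (y :+ (con 0 :* z :+ con 0)) := x :+ (y :+ con 0)) refl
            (cs 0F * C i 0F j) (cs 1F * C i 1F j) (C i 2F j))
          (eq j))

  -- Pairs of lifted planes.

  lincomb-difference : ∀ {m n} (cs : Vect m) (A B : Mat m n) j →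
    lincomb cs A j ≈ lincomb cs B j → lincomb cs (A -ᴹ B) j ≈ 0#
  lincomb-difference cs A B j eq = begin
    sumF (λ i → cs i * (A i j - B i j))                   ≈⟨ sumF-cong (λ i → expand (cs i) (A i j) (B i j)) ⟩
    sumF (λ i → 1# * (cs i * A i j) + - 1# * (cs i * B i j)) ≈⟨ sumF-linear 1# (- 1#) (λ i → cs i * A i j) (λ i → cs i * B i j) ⟩
    1# * lincomb cs A j + - 1# * lincomb cs B j           ≈⟨ +-cong (trans (*-identityˡ _) eq) (-1*x≈-x _) ⟩
    lincomb cs B j - lincomb cs B j                       ≈⟨ -‿inverseʳ _ ⟩
    0#                                                    ∎
    where
    expand : ∀ c x y → c * (x - y) ≈ 1# * (c * x) + - 1# * (c * y)
    expand c x y = trans (x[y-z]≈xy-xz c x y) (+-cong (sym (*-identityˡ _)) (sym (-1*x≈-x _)))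

  -- Equal rows satisfy the relation (1, -1). This recovers injectivity of the row selection in
  -- `RankAtLeast`, whose definition does not ask for it.
  LinIndep⇒distinct-rows : ∀ {n} (M : Mat 2 n) → LinIndep M → ¬ (∀ j → M 0F j ≈ M 1F j)
  LinIndep⇒distinct-rows M indep M₀≈M₁ = nontrivial (sym (indep (1# ∷ - 1# ∷ []) (λ j → begin
    1# * M 0F j + (- 1# * M 1F j + 0#)  ≈⟨ +-cong (trans (*-identityˡ _) (M₀≈M₁ j)) (trans (+-identityʳ _) (-1*x≈-x _)) ⟩
    M 1F j - M 1F j                     ≈⟨ -‿inverseʳ _ ⟩
    0#                                  ∎) 0F))

  all₃ : ∀ {p} {P : Fin 3 → Set p} → P 0F → P 1F → P 2F → ∀ i → P i
  all₃ p₀ p₁ p₂ 0F = p₀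
  all₃ p₀ p₁ p₂ 1F = p₁
  all₃ p₀ p₁ p₂ 2F = p₂

  -- The index `k` completes `a` and `b` to all of `Fin 3`. The left-hand sum is bracketed as `sumF`
  -- unfolds over the two selected rows, followed by the remaining term.
  third-index : ∀ (a b : Fin 3) → a ≢ b → ∃ λ k →
    (∀ (f : Fin 3 → Carrier) → (f a + (f b + 0#)) + f k ≈ sumF f) ×
    (∀ (P : Fin 3 → Set ℓ) → P a → P b → P k → ∀ i → P i)
  third-index 0F 0F a≢b = ⊥-elim (a≢b ≡.refl)
  third-index 1F 1F a≢b = ⊥-elim (a≢b ≡.refl)
  third-index 2F 2F a≢b = ⊥-elim (a≢b ≡.refl)
  third-index 0F 1F _ = 2F ,
    (λ f → solve 3 (λ x y z → (x :+ (y :+ con 0)) :+ z := x :+ (y :+ (z :+ con 0))) refl (f 0F) (f 1F) (f 2F)) ,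
    (λ P pa pb pk → all₃ pa pb pk)
  third-index 0F 2F _ = 1F ,
    (λ f → solve 3 (λ x y z → (x :+ (z :+ con 0)) :+ y := x :+ (y :+ (z :+ con 0))) refl (f 0F) (f 1F) (f 2F)) ,
    (λ P pa pb pk → all₃ pa pk pb)
  third-index 1F 0F _ = 2F ,
    (λ f → solve 3 (λ x y z → (y :+ (x :+ con 0)) :+ z := x :+ (y :+ (z :+ con 0))) refl (f 0F) (f 1F) (f 2F)) ,
    (λ P pa pb pk → all₃ pb pa pk)
  third-index 1F 2F _ = 0F ,
    (λ f → solve 3 (λ x y z → (y :+ (z :+ con 0)) :+ x := x :+ (y :+ (z :+ con 0))) refl (f 0F) (f 1F) (f 2F)) ,
    (λ P pa pb pk → all₃ pk pa pb)
  third-index 2F 0F _ = 1F ,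
    (λ f → solve 3 (λ x y z → (z :+ (x :+ con 0)) :+ y := x :+ (y :+ (z :+ con 0))) refl (f 0F) (f 1F) (f 2F)) ,
    (λ P pa pb pk → all₃ pb pk pa)
  third-index 2F 1F _ = 0F ,
    (λ f → solve 3 (λ x y z → (z :+ (y :+ con 0)) :+ x := x :+ (y :+ (z :+ con 0))) refl (f 0F) (f 1F) (f 2F)) ,
    (λ P pa pb pk → all₃ pk pb pa)

  lincomb-lift-↑ˡ : ∀ cs A (i : Fin 3) → lincomb cs (lift A) (i ↑ˡ 4) ≈ cs i
  lincomb-lift-↑ˡ cs A 0F = solve 3 (λ x y z → x :* con 1 :+ (y :* con 0 :+ (z :* con 0 :+ con 0)) := x) refl (cs 0F) (cs 1F) (cs 2F)
  lincomb-lift-↑ˡ cs A 1F = solve 3 (λ x y z → x :* con 0 :+ (y :* con 1 :+ (z :* con 0 :+ con 0)) := y) refl (cs 0F) (cs 1F) (cs 2F)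
  lincomb-lift-↑ˡ cs A 2F = solve 3 (λ x y z → x :* con 0 :+ (y :* con 0 :+ (z :* con 1 :+ con 0)) := z) refl (cs 0F) (cs 1F) (cs 2F)

  lift-LinIndep : ∀ A → LinIndep (lift A)
  lift-LinIndep A cs eq i = trans (sym (lincomb-lift-↑ˡ cs A i)) (eq (i ↑ˡ 4))

  -- The identity blocks give a common vector the same coefficients in both planes, so these
  -- coefficients annihilate A - B. Once the coefficient of the unselected row `k` is zero, what
  -- remains is a relation between the two independent rows chosen by `σ`.
  lift-lift : ∀ A B → RankAtLeast 2 (A -ᴹ B) → IntersectDimAtMost1 (lift A) (lift B)
  lift-lift A B (σ , indep) with third-index (σ 0F) (σ 1F)
    (λ σ₀≡σ₁ → LinIndep⇒distinct-rows (λ l → (A -ᴹ B) (σ l)) indep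
      (λ j → reflexive (≡.cong (λ i → (A -ᴹ B) i j) σ₀≡σ₁)))
  ... | k , sum-split , cover = coordinate-criterion (lift A) (lift B) (k ↑ˡ 4) inj
    where
    inj : ∀ cs ds → (∀ j → lincomb cs (lift A) j ≈ lincomb ds (lift B) j) →
      lincomb cs (lift A) (k ↑ˡ 4) ≈ 0# → ∀ i → cs i ≈ 0#
    inj cs ds eq at-k = cover (λ i → cs i ≈ 0#) (cσ≈0 0F) (cσ≈0 1F) cₖ≈0
      where
      cₖ≈0 : cs k ≈ 0#
      cₖ≈0 = trans (sym (lincomb-lift-↑ˡ cs A k)) at-k

      cs≈ds : ∀ i → cs i ≈ ds i
      cs≈ds i = trans (sym (lincomb-lift-↑ˡ cs A i)) (trans (eq (i ↑ˡ 4)) (lincomb-lift-↑ˡ ds B i))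

      difference≈0 : ∀ j → lincomb cs (A -ᴹ B) j ≈ 0#
      difference≈0 j = lincomb-difference cs A B j
        (trans (eq (3 ↑ʳ j)) (sumF-cong {f = λ i → ds i * B i j} {λ i → cs i * B i j}
          (λ i → *-congʳ (sym (cs≈ds i)))))

      cσ≈0 : ∀ l → cs (σ l) ≈ 0#
      cσ≈0 = indep (cs ∘ σ) (λ j → begin
        lincomb (cs ∘ σ) (λ l → (A -ᴹ B) (σ l)) j                              ≈⟨ +-identityʳ _ ⟨
        lincomb (cs ∘ σ) (λ l → (A -ᴹ B) (σ l)) j + 0#                         ≈⟨ +-congˡ (*-zeroˡ cₖ≈0) ⟨
        lincomb (cs ∘ σ) (λ l → (A -ᴹ B) (σ l)) j + cs k * (A -ᴹ B) k j        ≈⟨ sum-split (λ i → cs i * (A -ᴹ B) i j) ⟩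
        lincomb cs (A -ᴹ B) j                                                  ≈⟨ difference≈0 j ⟩
        0#                                                                     ∎)

-- The additional planes, built from points of the projective line.

module Planes {c ℓ} (R : CommutativeRing c ℓ) (isField : Lin.IsField R)
  (q : ℕ) (φ : Fin q → CommutativeRing.Carrier R)
  (φ-injective : ∀ {i j} → CommutativeRing._≈_ R (φ i) (φ j) → i ≡ j) where

  open CommutativeRing R hiding (zero)
  open Lin R
  open import Algebra.Properties.Ring ring
  open import Algebra.Solver.Ring.NaturalCoefficients.Default commutativeSemiring
    using (solve; _:=_; _:+_; _:*_; con)
  open import Relation.Binary.Reasoning.Setoid (CommutativeRing.setoid R)
  open Subspaces R isField
  open CyclicSum q

  -- Planes are parametrised by indices in `Fin q`, on which cases can be decided; injectivity of
  -- `φ` carries a difference of indices over to scalars.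
  scalar-zero-φ : ∀ {a i j} → i ≢ j → a * φ i ≈ a * φ j → a ≈ 0#
  scalar-zero-φ i≢j = scalar-zero (i≢j ∘ φ-injective)

  -- The points of PG(1,q), each completed to a basis of F² by its copoint.
  point copoint : Fin (suc q) → Vect 2
  point zero    = 0# ∷ 1# ∷ []
  point (suc m) = 1# ∷ φ m ∷ []
  copoint zero    = 1# ∷ 0# ∷ []
  copoint (suc m) = 0# ∷ 1# ∷ []

  -- The coordinate where the point has entry 1 and its copoint entry 0, so that it reads off the
  -- coefficient of the point.
  pivot : Fin (suc q) → Fin 2
  pivot zero    = 1F
  pivot (suc m) = 0F

  x1+y0≈x : ∀ x y → x * 1# + y * 0# ≈ x
  x1+y0≈x = solve 2 (λ x y → x :* con 1 :+ y :* con 0 := x) refl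

  x0+y1≈y : ∀ x y → x * 0# + y * 1# ≈ y
  x0+y1≈y = solve 2 (λ x y → x :* con 0 :+ y :* con 1 := y) refl

  pivot-coordinate : ∀ i a b → a * point i (pivot i) + b * copoint i (pivot i) ≈ a
  pivot-coordinate zero    = x1+y0≈x
  pivot-coordinate (suc m) = x1+y0≈x

  point-pivot : ∀ i a → a * point i (pivot i) ≈ a
  point-pivot zero    = *-identityʳ
  point-pivot (suc m) = *-identityʳ

  point-copoint-basis : ∀ i {a b a′ b′} →
    (∀ u → a * point i u + b * copoint i u ≈ a′ * point i u + b′ * copoint i u) →
    a ≈ a′ × b ≈ b′
  point-copoint-basis zero {a} {b} {a′} {b′} eq =
      trans (sym (x1+y0≈x a b)) (trans (eq 1F) (x1+y0≈x a′ b′))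
    , trans (sym (x0+y1≈y a b)) (trans (eq 0F) (x0+y1≈y a′ b′))
  point-copoint-basis (suc m) {a} {b} {a′} {b′} eq = a≈a′ , b≈b′
    where
    a≈a′ : a ≈ a′
    a≈a′ = trans (sym (x1+y0≈x a b)) (trans (eq 0F) (x1+y0≈x a′ b′))
    b≈b′ : b ≈ b′
    b≈b′ = trans (sym (*-identityʳ b)) (trans
      (+-cancelˡ (a * φ m) (b * 1#) (b′ * 1#) (trans (eq 1F) (+-congʳ (*-congʳ (sym a≈a′)))))
      (*-identityʳ b′))

  -- For two points with first entry 1, the first coordinate equates the multipliers and the second
  -- then kills them. If one point is (0, 1), the first coordinate kills the multiplier of the other
  -- point, and the second coordinate does the rest.
  point-separated : ∀ i j {a b} → i ≢ j → (∀ u → a * point i u ≈ b * point j u) → a ≈ 0# × b ≈ 0#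
  point-separated zero zero i≢j eq = ⊥-elim (i≢j ≡.refl)
  point-separated zero (suc n) {a} {b} i≢j eq = a≈0 , b≈0
    where
    b≈0 : b ≈ 0#
    b≈0 = trans (sym (*-identityʳ b)) (trans (sym (eq 0F)) (zeroʳ a))
    a≈0 : a ≈ 0#
    a≈0 = trans (sym (*-identityʳ a)) (trans (eq 1F) (*-zeroˡ b≈0))
  point-separated (suc m) zero {a} {b} i≢j eq = a≈0 , b≈0
    where
    a≈0 : a ≈ 0#
    a≈0 = trans (sym (*-identityʳ a)) (trans (eq 0F) (zeroʳ b))
    b≈0 : b ≈ 0#
    b≈0 = trans (sym (*-identityʳ b)) (trans (sym (eq 1F)) (*-zeroˡ a≈0))
  point-separated (suc m) (suc n) {a} {b} i≢j eq = a≈0 , trans (sym a≈b) a≈0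
    where
    a≈b : a ≈ b
    a≈b = trans (sym (*-identityʳ a)) (trans (eq 0F) (*-identityʳ b))
    a≈0 : a ≈ 0#
    a≈0 = scalar-zero-φ (i≢j ∘ ≡.cong suc) (trans (eq 1F) (*-congʳ (sym a≈b)))

  -- Generic vectors of the planes in closed form.

  -- Wrapping the equation in a record keeps `M` and `f` inferable from a proof of it.
  record HasCoordinates (M : Mat 3 7) (f : Vect 3 → Vect 7) : Set (c ⊔ ℓ) where
    constructor coordinates
    field lincomb≈ : ∀ cs j → lincomb cs M j ≈ f cs j

  open HasCoordinates

  coordinates-LinIndep : ∀ {M f} → HasCoordinates M f →
    (∀ cs → (∀ j → f cs j ≈ 0#) → ∀ i → cs i ≈ 0#) → LinIndep M
  coordinates-LinIndep M≈f inj cs eq = inj cs (λ j → trans (sym (lincomb≈ M≈f cs j)) (eq j))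

  coordinates-criterion : ∀ {M N f g} → HasCoordinates M f → HasCoordinates N g → (k : Fin 7) →
    (∀ cs ds → (∀ j → f cs j ≈ g ds j) → f cs k ≈ 0# → ∀ i → cs i ≈ 0#) → IntersectDimAtMost1 M N
  coordinates-criterion {M} {N} M≈f N≈g k inj = coordinate-criterion M N k λ cs ds eq at-k →
    inj cs ds (λ j → trans (sym (lincomb≈ M≈f cs j)) (trans (eq j) (lincomb≈ N≈g ds j))) (trans (sym (lincomb≈ M≈f cs k)) at-k)

  -- The first three coordinates of a vector in a lifted plane are its coefficients. In a plane ⟨ℓ,
  -- (p ∣ s)⟩ they form a multiple of p, so `k` can be any position where p is nonzero.
  lift-criterion : ∀ A {M f} → HasCoordinates M f → (k : Fin 3) →
    (∀ cs → f cs (k ↑ˡ 4) ≈ 0# → ∀ (i : Fin 3) → f cs (i ↑ˡ 4) ≈ 0#) → IntersectDimAtMost1 (lift A) M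
  lift-criterion A {M} M≈f k vanish = coordinate-criterion (lift A) M (k ↑ˡ 4) λ cs ds eq at-k i →
    let eq′ : ∀ l → lincomb cs (lift A) l ≈ _
        eq′ l = trans (eq l) (lincomb≈ M≈f ds l)
    in trans (sym (lincomb-lift-↑ˡ cs A i)) (trans (eq′ (i ↑ˡ 4))
         (vanish ds (trans (sym (eq′ (k ↑ˡ 4))) at-k) i))

  -- In the three families below, rows 0 and 1 span the line in S and row 2 is (p ∣ s).
  skewPlane : (x y z d : Fin q) → Mat 3 7
  skewPlane x y z d 0F = 0# ∷ 0#  ∷ 0#  ∷ 1# ∷ 0# ∷ φ x ∷ φ y         ∷ []
  skewPlane x y z d 1F = 0# ∷ 0#  ∷ 0#  ∷ 0# ∷ 1# ∷ φ z ∷ (φ x + φ d) ∷ []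
  skewPlane x y z d 2F = 1# ∷ φ y ∷ φ d ∷ 0# ∷ 0# ∷ 0#  ∷ φ z         ∷ []

  meetingPlane : (i j : Fin (suc q)) (k : Fin q) → Mat 3 7
  meetingPlane i j k 0F = 0# ∷ 0# ∷ 0# ∷ 0# ∷ 0# ∷ point i 0F ∷ point i 1F ∷ []
  meetingPlane i j k 1F = 0# ∷ 0# ∷ 0# ∷ point j 0F ∷ point j 1F ∷ φ k * copoint i 0F ∷ φ k * copoint i 1F ∷ []
  meetingPlane i j k 2F = 0# ∷ point (i ⊕ j) 0F ∷ point (i ⊕ j) 1F ∷ φ k * copoint j 0F ∷ φ k * copoint j 1F ∷ 0# ∷ 0# ∷ []

  axisPlane : Mat 3 7
  axisPlane 0F = 0# ∷ 0# ∷ 0# ∷ 0# ∷ 0# ∷ 1# ∷ 0# ∷ []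
  axisPlane 1F = 0# ∷ 0# ∷ 0# ∷ 0# ∷ 0# ∷ 0# ∷ 1# ∷ []
  axisPlane 2F = 1# ∷ 0# ∷ 0# ∷ 0# ∷ 0# ∷ 0# ∷ 0# ∷ []

  skewCoordinates : (x y z d : Fin q) → Vect 3 → Vect 7
  skewCoordinates x y z d cs =
    cs 2F ∷ cs 2F * φ y ∷ cs 2F * φ d ∷ cs 0F ∷ cs 1F ∷
    cs 0F * φ x + cs 1F * φ z ∷ cs 0F * φ y + (cs 1F * (φ x + φ d) + cs 2F * φ z) ∷ []

  -- The scalar `φ k` enters both ℓ and s, each time along a copoint. Hence `middle` is an expansion
  -- in the basis belonging to `j` and `bottom` one in the basis belonging to `i`, so coefficients
  -- can be compared when these indices agree.
  meetingCoordinates : (i j : Fin (suc q)) (k : Fin q) → Vect 3 → Vect 7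
  meetingCoordinates i j k cs =
    0# ∷ cs 2F * point (i ⊕ j) 0F ∷ cs 2F * point (i ⊕ j) 1F ∷
    middle 0F ∷ middle 1F ∷ bottom 0F ∷ bottom 1F ∷ []
    where
    middle bottom : Vect 2
    middle u = cs 1F * point j u + cs 2F * φ k * copoint j u
    bottom u = cs 0F * point i u + cs 1F * φ k * copoint i u

  axisCoordinates : Vect 3 → Vect 7
  axisCoordinates cs = cs 2F ∷ 0# ∷ 0# ∷ 0# ∷ 0# ∷ cs 0F ∷ cs 1F ∷ []

  dot-100 : ∀ a b c → a * 1# + (b * 0# + (c * 0# + 0#)) ≈ a
  dot-100 = solve 3 (λ a b c → a :* con 1 :+ (b :* con 0 :+ (c :* con 0 :+ con 0)) := a) refl

  dot-010 : ∀ a b c → a * 0# + (b * 1# + (c * 0# + 0#)) ≈ b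
  dot-010 = solve 3 (λ a b c → a :* con 0 :+ (b :* con 1 :+ (c :* con 0 :+ con 0)) := b) refl

  dot-00x : ∀ a b c x → a * 0# + (b * 0# + (c * x + 0#)) ≈ c * x
  dot-00x = solve 4 (λ a b c x → a :* con 0 :+ (b :* con 0 :+ (c :* x :+ con 0)) := c :* x) refl

  dot-001 : ∀ a b c → a * 0# + (b * 0# + (c * 1# + 0#)) ≈ c
  dot-001 a b c = trans (dot-00x a b c 1#) (*-identityʳ c)

  dot-000 : ∀ a b c → a * 0# + (b * 0# + (c * 0# + 0#)) ≈ 0#
  dot-000 a b c = trans (dot-00x a b c 0#) (zeroʳ c)

  skew-hasCoordinates : ∀ x y z d → HasCoordinates (skewPlane x y z d) (skewCoordinates x y z d)
  skew-hasCoordinates x y z d = coordinates λ cs → λ where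
    0F → dot-001 (cs 0F) (cs 1F) (cs 2F)
    1F → dot-00x (cs 0F) (cs 1F) (cs 2F) (φ y)
    2F → dot-00x (cs 0F) (cs 1F) (cs 2F) (φ d)
    3F → dot-100 (cs 0F) (cs 1F) (cs 2F)
    4F → dot-010 (cs 0F) (cs 1F) (cs 2F)
    5F → solve 5 (λ a b c x z → a :* x :+ (b :* z :+ (c :* con 0 :+ con 0)) := a :* x :+ b :* z) refl
           (cs 0F) (cs 1F) (cs 2F) (φ x) (φ z)
    6F → +-congˡ (+-congˡ (+-identityʳ _))

  meeting-hasCoordinates : ∀ i j k → HasCoordinates (meetingPlane i j k) (meetingCoordinates i j k)
  meeting-hasCoordinates i j k = coordinates λ cs → λ where
      0F → dot-000 (cs 0F) (cs 1F) (cs 2F)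
      1F → dot-00x (cs 0F) (cs 1F) (cs 2F) (point (i ⊕ j) 0F)
      2F → dot-00x (cs 0F) (cs 1F) (cs 2F) (point (i ⊕ j) 1F)
      3F → middle cs 0F
      4F → middle cs 1F
      5F → bottom cs 0F
      6F → bottom cs 1F
    where
    middle : ∀ (cs : Vect 3) u → cs 0F * 0# + (cs 1F * point j u + (cs 2F * (φ k * copoint j u) + 0#)) ≈
                      cs 1F * point j u + cs 2F * φ k * copoint j u
    middle cs u = solve 6 (λ a b c p k r → a :* con 0 :+ (b :* p :+ (c :* (k :* r) :+ con 0)) := b :* p :+ c :* k :* r) refl
      (cs 0F) (cs 1F) (cs 2F) (point j u) (φ k) (copoint j u)
    bottom : ∀ (cs : Vect 3) u → cs 0F * point i u + (cs 1F * (φ k * copoint i u) + (cs 2F * 0# + 0#)) ≈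
                     cs 0F * point i u + cs 1F * φ k * copoint i u
    bottom cs u = solve 6 (λ a b c p k r → a :* p :+ (b :* (k :* r) :+ (c :* con 0 :+ con 0)) := a :* p :+ b :* k :* r) refl
      (cs 0F) (cs 1F) (cs 2F) (point i u) (φ k) (copoint i u)

  axis-hasCoordinates : HasCoordinates axisPlane axisCoordinates
  axis-hasCoordinates = coordinates λ cs → λ where
    0F → dot-001 (cs 0F) (cs 1F) (cs 2F)
    1F → dot-000 (cs 0F) (cs 1F) (cs 2F)
    2F → dot-000 (cs 0F) (cs 1F) (cs 2F)
    3F → dot-000 (cs 0F) (cs 1F) (cs 2F)
    4F → dot-000 (cs 0F) (cs 1F) (cs 2F)
    5F → dot-100 (cs 0F) (cs 1F) (cs 2F)
    6F → dot-010 (cs 0F) (cs 1F) (cs 2F)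

  -- Pairs involving planes over lines skew to ℓ₀.

  drop-right : ∀ {a b} x y → b ≈ 0# → a * x + b * y ≈ a * x
  drop-right x y b≈0 = trans (+-congˡ (*-zeroˡ b≈0)) (+-identityʳ _)

  -- Coordinates 0, 3 and 4 are the coefficients themselves, so a common vector has the same `α`,
  -- `β`, `γ` in both planes. The other four coordinates become equations between the two parameter
  -- sets with these shared coefficients.
  module SkewPair (x y z d x′ y′ z′ d′ : Fin q) (cs ds : Vect 3)
    (eq : ∀ j → skewCoordinates x y z d cs j ≈ skewCoordinates x′ y′ z′ d′ ds j) where

    α β γ : Carrier
    α = cs 0F
    β = cs 1F
    γ = cs 2F

    eq₁ : γ * φ y ≈ γ * φ y′
    eq₁ = trans (eq 1F) (*-congʳ (sym (eq 0F)))

    eq₂ : γ * φ d ≈ γ * φ d′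
    eq₂ = trans (eq 2F) (*-congʳ (sym (eq 0F)))

    eq₅ : α * φ x + β * φ z ≈ α * φ x′ + β * φ z′
    eq₅ = trans (eq 5F) (+-cong (*-congʳ (sym (eq 3F))) (*-congʳ (sym (eq 4F))))

    eq₆ : α * φ y + (β * (φ x + φ d) + γ * φ z) ≈ α * φ y′ + (β * (φ x′ + φ d′) + γ * φ z′)
    eq₆ = trans (eq 6F) (+-cong (*-congʳ (sym (eq 3F))) (+-cong (*-congʳ (sym (eq 4F))) (*-congʳ (sym (eq 0F)))))

    α≈0-of-x : x ≢ x′ → β ≈ 0# → α ≈ 0#
    α≈0-of-x x≢x′ β≈0 = scalar-zero-φ x≢x′
      (trans (sym (drop-right _ _ β≈0)) (trans eq₅ (drop-right _ _ β≈0)))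

    γ≈0-of-y : y ≢ y′ → γ ≈ 0#
    γ≈0-of-y y≢y′ = scalar-zero-φ y≢y′ eq₁

    γ≈0-of-d : d ≢ d′ → γ ≈ 0#
    γ≈0-of-d d≢d′ = scalar-zero-φ d≢d′ eq₂

    eq₆-without-γ : γ ≈ 0# → α * φ y + β * (φ x + φ d) ≈ α * φ y′ + β * (φ x′ + φ d′)
    eq₆-without-γ γ≈0 = trans (+-congˡ (sym (drop-right _ _ γ≈0))) (trans eq₆ (+-congˡ (drop-right _ _ γ≈0)))

    α≈0-of-y : y ≢ y′ → β ≈ 0# → α ≈ 0#
    α≈0-of-y y≢y′ β≈0 = scalar-zero-φ y≢y′ (trans (sym (drop-right _ _ β≈0))
      (trans (eq₆-without-γ (γ≈0-of-y y≢y′)) (drop-right _ _ β≈0)))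

    eq₆-β : y ≡ y′ → γ ≈ 0# → β * φ x + β * φ d ≈ β * φ x′ + β * φ d′
    eq₆-β ≡.refl γ≈0 = trans (sym (distribˡ _ _ _))
      (trans (+-cancelˡ (α * φ y) _ _ (eq₆-without-γ γ≈0)) (distribˡ _ _ _))

    β≈0-of-x : x ≢ x′ → y ≡ y′ → d ≡ d′ → γ ≈ 0# → β ≈ 0#
    β≈0-of-x x≢x′ y≡y′ ≡.refl γ≈0 = scalar-zero-φ x≢x′ (+-cancelʳ (β * φ d) _ _ (eq₆-β y≡y′ γ≈0))

    β≈0-of-d : x ≡ x′ → y ≡ y′ → d ≢ d′ → β ≈ 0#
    β≈0-of-d ≡.refl y≡y′ d≢d′ = scalar-zero-φ d≢d′ (+-cancelˡ (β * φ x) _ _ (eq₆-β y≡y′ (γ≈0-of-d d≢d′)))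

    β≈0-of-z : x ≡ x′ → z ≢ z′ → β ≈ 0#
    β≈0-of-z ≡.refl z≢z′ = scalar-zero-φ z≢z′ (+-cancelˡ (α * φ x) _ _ eq₅)

    γ≈0-of-z : x ≡ x′ → y ≡ y′ → d ≡ d′ → z ≢ z′ → γ ≈ 0#
    γ≈0-of-z ≡.refl ≡.refl ≡.refl z≢z′ = scalar-zero-φ z≢z′
      (+-cancelˡ (β * (φ x + φ d)) _ _ (+-cancelˡ (α * φ y) _ _ eq₆))

  -- In each case one coefficient is set to zero through the chosen coordinate, and the other two
  -- are eliminated by cancelling nonzero parameter differences.
  skew-skew : ∀ x y z d x′ y′ z′ d′ → (x , y , z , d) ≢ (x′ , y′ , z′ , d′) →
    IntersectDimAtMost1 (skewPlane x y z d) (skewPlane x′ y′ z′ d′)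
  skew-skew x y z d x′ y′ z′ d′ different = go (x ≟ x′) (y ≟ y′) (d ≟ d′) (z ≟ z′)
    where
    criterion = coordinates-criterion (skew-hasCoordinates x y z d) (skew-hasCoordinates x′ y′ z′ d′)
    module P = SkewPair x y z d x′ y′ z′ d′

    go : Dec (x ≡ x′) → Dec (y ≡ y′) → Dec (d ≡ d′) → Dec (z ≡ z′) →
      IntersectDimAtMost1 (skewPlane x y z d) (skewPlane x′ y′ z′ d′)
    -- Here p differs, so γ = 0; with β = 0 as well, the last coordinate isolates α.
    go _ (no y≢) _ _ = criterion 4F λ cs ds eq β≈0 → let open P cs ds eq in
      all₃ (α≈0-of-y y≢ β≈0) β≈0 (γ≈0-of-y y≢)
    go (no x≢) (yes _) (no d≢) _ = criterion 4F λ cs ds eq β≈0 → let open P cs ds eq in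
      all₃ (α≈0-of-x x≢ β≈0) β≈0 (γ≈0-of-d d≢)
    -- Equal p, with a = x - x′ nonzero in the difference matrix: after γ = 0 the last coordinate
    -- gives βa = 0, and then coordinate 5 gives αa = 0.
    go (no x≢) (yes y≡) (yes d≡) _ = criterion 0F λ cs ds eq γ≈0 → let open P cs ds eq in
      let β≈0 = β≈0-of-x x≢ y≡ d≡ γ≈0 in all₃ (α≈0-of-x x≢ β≈0) β≈0 γ≈0
    go (yes x≡) (yes y≡) (no d≢) _ = criterion 3F λ cs ds eq α≈0 → let open P cs ds eq in
      all₃ α≈0 (β≈0-of-d x≡ y≡ d≢) (γ≈0-of-d d≢)
    -- Equal p and a = 0, so b = z - z′ is nonzero: coordinates 5 and 6 reduce to βb = 0 and γb = 0.
    go (yes x≡) (yes y≡) (yes d≡) (no z≢) = criterion 3F λ cs ds eq α≈0 → let open P cs ds eq in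
      all₃ α≈0 (β≈0-of-z x≡ z≢) (γ≈0-of-z x≡ y≡ d≡ z≢)
    go (yes ≡.refl) (yes ≡.refl) (yes ≡.refl) (yes ≡.refl) = ⊥-elim (different ≡.refl)

  -- The points p may coincide, but the lines are disjoint: coordinates 3 and 4 vanish on the whole
  -- axis plane and equal α and β on the skew one.
  skew-axis : ∀ x y z d → IntersectDimAtMost1 (skewPlane x y z d) axisPlane
  skew-axis x y z d = coordinates-criterion (skew-hasCoordinates x y z d) axis-hasCoordinates 0F
    λ cs ds eq γ≈0 → all₃ (eq 3F) (eq 4F) γ≈0

  -- Pairs involving planes over lines that meet ℓ₀ in a point.

  -- After a leading 0, the coordinates of a meeting plane form three pairs; indexing each pair by
  -- `Fin 2` lets `pivot` select an entry. The form of `topIndex` agrees definitionally with the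
  -- positions in `lift-criterion`.
  topIndex middleIndex bottomIndex : Fin 2 → Fin 7
  topIndex u = suc u ↑ˡ 4
  middleIndex 0F = 3F
  middleIndex 1F = 4F
  bottomIndex 0F = 5F
  bottomIndex 1F = 6F

  meeting-top : ∀ i j k cs u → meetingCoordinates i j k cs (topIndex u) ≡ cs 2F * point (i ⊕ j) u
  meeting-top i j k cs 0F = ≡.refl
  meeting-top i j k cs 1F = ≡.refl

  meeting-middle : ∀ i j k cs u →
    meetingCoordinates i j k cs (middleIndex u) ≡ cs 1F * point j u + cs 2F * φ k * copoint j u
  meeting-middle i j k cs 0F = ≡.refl
  meeting-middle i j k cs 1F = ≡.refl

  meeting-bottom : ∀ i j k cs u →
    meetingCoordinates i j k cs (bottomIndex u) ≡ cs 0F * point i u + cs 1F * φ k * copoint i u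
  meeting-bottom i j k cs 0F = ≡.refl
  meeting-bottom i j k cs 1F = ≡.refl

  γ≈0-from-top : ∀ i j k cs → meetingCoordinates i j k cs (topIndex (pivot (i ⊕ j))) ≈ 0# → cs 2F ≈ 0#
  γ≈0-from-top i j k cs eq = trans (sym (point-pivot (i ⊕ j) (cs 2F)))
    (trans (sym (reflexive (meeting-top i j k cs _))) eq)

  β≈0-from-middle : ∀ i j k cs → meetingCoordinates i j k cs (middleIndex (pivot j)) ≈ 0# → cs 1F ≈ 0#
  β≈0-from-middle i j k cs eq = trans (sym (pivot-coordinate j (cs 1F) _))
    (trans (sym (reflexive (meeting-middle i j k cs _))) eq)

  α≈0-from-bottom : ∀ i j k cs → meetingCoordinates i j k cs (bottomIndex (pivot i)) ≈ 0# → cs 0F ≈ 0#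
  α≈0-from-bottom i j k cs eq = trans (sym (pivot-coordinate i (cs 0F) _))
    (trans (sym (reflexive (meeting-bottom i j k cs _))) eq)

  -- The leading 0 gives γ = 0 and then γ′ = 0, so common vectors lie in S. There the coordinates 3
  -- and 4 determine the vector of the skew line and are β′ times the point `j`; the pivot of `j`
  -- therefore decides everything.
  skew-meeting : ∀ x y z d i j k → IntersectDimAtMost1 (skewPlane x y z d) (meetingPlane i j k)
  skew-meeting x y z d i j k = coordinates-criterion
    (skew-hasCoordinates x y z d) (meeting-hasCoordinates i j k) (middleIndex (pivot j)) λ cs ds eq at-pivot →
    let γ≈0 : cs 2F ≈ 0#
        γ≈0 = eq 0F
        γ′≈0 : ds 2F ≈ 0#
        γ′≈0 = γ≈0-from-top i j k ds
          (trans (sym (eq (topIndex (pivot (i ⊕ j))))) (top≈0 cs γ≈0 (pivot (i ⊕ j))))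
        β′≈0 : ds 1F ≈ 0#
        β′≈0 = β≈0-from-middle i j k ds (trans (sym (eq (middleIndex (pivot j)))) at-pivot)
        middle≈0 : ∀ u → ds 1F * point j u + ds 2F * φ k * copoint j u ≈ 0#
        middle≈0 u = trans (drop-right _ _ (*-zeroˡ γ′≈0)) (*-zeroˡ β′≈0)
    in all₃ (trans (eq 3F) (middle≈0 0F)) (trans (eq 4F) (middle≈0 1F)) γ≈0
    where
    top≈0 : ∀ cs → cs 2F ≈ 0# → ∀ u → skewCoordinates x y z d cs (topIndex u) ≈ 0#
    top≈0 cs γ≈0 0F = *-zeroˡ γ≈0
    top≈0 cs γ≈0 1F = *-zeroˡ γ≈0

  -- The axis plane is zero in the top and middle pairs, which forces γ = β = 0 and leaves multiples
  -- of the point `i` on ℓ₀.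
  meeting-axis : ∀ i j k → IntersectDimAtMost1 (meetingPlane i j k) axisPlane
  meeting-axis i j k = coordinates-criterion
    (meeting-hasCoordinates i j k) axis-hasCoordinates (bottomIndex (pivot i)) λ cs ds eq at-pivot →
    all₃ (α≈0-from-bottom i j k cs at-pivot)
         (β≈0-from-middle i j k cs (trans (eq (middleIndex (pivot j))) (middle≈0 ds (pivot j))))
         (γ≈0-from-top i j k cs (trans (eq (topIndex (pivot (i ⊕ j)))) (top≈0 ds (pivot (i ⊕ j)))))
    where
    top≈0 : ∀ ds u → axisCoordinates ds (topIndex u) ≈ 0#
    top≈0 ds 0F = refl
    top≈0 ds 1F = refl
    middle≈0 : ∀ ds u → axisCoordinates ds (middleIndex u) ≈ 0#
    middle≈0 ds 0F = refl
    middle≈0 ds 1F = refl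

  module MeetingPair (i j : Fin (suc q)) (k : Fin q) (i′ j′ : Fin (suc q)) (k′ : Fin q) (cs ds : Vect 3)
    (eq : ∀ l → meetingCoordinates i j k cs l ≈ meetingCoordinates i′ j′ k′ ds l) where

    α β γ α′ β′ γ′ : Carrier
    α = cs 0F
    β = cs 1F
    γ = cs 2F
    α′ = ds 0F
    β′ = ds 1F
    γ′ = ds 2F

    top : ∀ u → γ * point (i ⊕ j) u ≈ γ′ * point (i′ ⊕ j′) u
    top u = trans (sym (reflexive (meeting-top i j k cs u)))
      (trans (eq (topIndex u)) (reflexive (meeting-top i′ j′ k′ ds u)))

    middle : ∀ u → β * point j u + γ * φ k * copoint j u ≈ β′ * point j′ u + γ′ * φ k′ * copoint j′ u
    middle u = trans (sym (reflexive (meeting-middle i j k cs u)))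
      (trans (eq (middleIndex u)) (reflexive (meeting-middle i′ j′ k′ ds u)))

    bottom : ∀ u → α * point i u + β * φ k * copoint i u ≈ α′ * point i′ u + β′ * φ k′ * copoint i′ u
    bottom u = trans (sym (reflexive (meeting-bottom i j k cs u)))
      (trans (eq (bottomIndex u)) (reflexive (meeting-bottom i′ j′ k′ ds u)))

    γ-separated : i ⊕ j ≢ i′ ⊕ j′ → γ ≈ 0# × γ′ ≈ 0#
    γ-separated different = point-separated _ _ different top

    γ′≈0-of-γ≈0 : γ ≈ 0# → γ′ ≈ 0#
    γ′≈0-of-γ≈0 γ≈0 = trans (sym (point-pivot (i′ ⊕ j′) γ′))
      (trans (sym (top (pivot (i′ ⊕ j′)))) (*-zeroˡ γ≈0))

    β-separated : j ≢ j′ → γ ≈ 0# → γ′ ≈ 0# → β ≈ 0# × β′ ≈ 0#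
    β-separated j≢j′ γ≈0 γ′≈0 = point-separated j j′ j≢j′ λ u →
      trans (sym (drop-right _ _ (*-zeroˡ γ≈0))) (trans (middle u) (drop-right _ _ (*-zeroˡ γ′≈0)))

    α-separated : i ≢ i′ → β ≈ 0# → β′ ≈ 0# → α ≈ 0# × α′ ≈ 0#
    α-separated i≢i′ β≈0 β′≈0 = point-separated i i′ i≢i′ λ u →
      trans (sym (drop-right _ _ (*-zeroˡ β≈0))) (trans (bottom u) (drop-right _ _ (*-zeroˡ β′≈0)))

    middle-same : j ≡ j′ → β ≈ β′ × γ * φ k ≈ γ′ * φ k′
    middle-same ≡.refl = point-copoint-basis j middle

    bottom-same : i ≡ i′ → α ≈ α′ × β * φ k ≈ β′ * φ k′
    bottom-same ≡.refl = point-copoint-basis i bottom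

    γ≈γ′ : i ⊕ j ≡ i′ ⊕ j′ → γ ≈ γ′
    γ≈γ′ same = begin
      γ                                                   ≈⟨ point-pivot (i ⊕ j) γ ⟨
      γ * point (i ⊕ j) (pivot (i ⊕ j))                   ≈⟨ top (pivot (i ⊕ j)) ⟩
      γ′ * point (i′ ⊕ j′) (pivot (i ⊕ j))                ≡⟨ ≡.cong (λ t → γ′ * point t (pivot (i ⊕ j))) same ⟨
      γ′ * point (i ⊕ j) (pivot (i ⊕ j))                  ≈⟨ point-pivot (i ⊕ j) γ′ ⟩
      γ′                                                  ∎

    γ≈0-of-k : k ≢ k′ → i ⊕ j ≡ i′ ⊕ j′ → j ≡ j′ → γ ≈ 0#
    γ≈0-of-k k≢k′ same j≡j′ = scalar-zero-φ k≢k′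
      (trans (proj₂ (middle-same j≡j′)) (*-congʳ (sym (γ≈γ′ same))))

    β≈0-of-k : k ≢ k′ → i ≡ i′ → j ≡ j′ → β ≈ 0#
    β≈0-of-k k≢k′ i≡i′ j≡j′ = scalar-zero-φ k≢k′
      (trans (proj₂ (bottom-same i≡i′)) (*-congʳ (sym (proj₁ (middle-same j≡j′)))))

  -- The Latin square decides when p can be shared: if exactly one of `i`, `j` changes, then `i ⊕ j`
  -- changes and common vectors lie in S.
  meeting-meeting : ∀ i j k i′ j′ k′ → (i , j , k) ≢ (i′ , j′ , k′) →
    IntersectDimAtMost1 (meetingPlane i j k) (meetingPlane i′ j′ k′)
  meeting-meeting i j k i′ j′ k′ different = go (i ≟ i′) (j ≟ j′) (k ≟ k′)
    where
    criterion = coordinates-criterion (meeting-hasCoordinates i j k) (meeting-hasCoordinates i′ j′ k′)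
    module P = MeetingPair i j k i′ j′ k′

    go : Dec (i ≡ i′) → Dec (j ≡ j′) → Dec (k ≡ k′) →
      IntersectDimAtMost1 (meetingPlane i j k) (meetingPlane i′ j′ k′)
    -- Here p may be shared, but the lines are disjoint: once γ = 0, the middle pair kills β and
    -- then the bottom pair kills α.
    go (no i≢) (no j≢) _ = criterion (topIndex (pivot (i ⊕ j))) λ cs ds eq at-pivot → let open P cs ds eq in
      let γ≈0 = γ≈0-from-top i j k cs at-pivot
          (β≈0 , β′≈0) = β-separated j≢ γ≈0 (γ′≈0-of-γ≈0 γ≈0)
      in all₃ (proj₁ (α-separated i≢ β≈0 β′≈0)) β≈0 γ≈0
    go (no i≢) (yes ≡.refl) _ = criterion (middleIndex (pivot j)) λ cs ds eq at-pivot → let open P cs ds eq in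
      let β≈0 = β≈0-from-middle i j k cs at-pivot
          β′≈0 = trans (sym (proj₁ (middle-same ≡.refl))) β≈0
      in all₃ (proj₁ (α-separated i≢ β≈0 β′≈0)) β≈0 (proj₁ (γ-separated (i≢ ∘ ⊕-cancelʳ j)))
    go (yes ≡.refl) (no j≢) _ = criterion (bottomIndex (pivot i)) λ cs ds eq at-pivot → let open P cs ds eq in
      let (γ≈0 , γ′≈0) = γ-separated (j≢ ∘ ⊕-cancelˡ i)
      in all₃ (α≈0-from-bottom i j k cs at-pivot) (proj₁ (β-separated j≢ γ≈0 γ′≈0)) γ≈0
    -- The point `i` is common to both planes, hence the choice α = 0. The copoint coefficients in
    -- the bottom and middle pairs give β(φ k - φ k′) = 0 and γ(φ k - φ k′) = 0.
    go (yes ≡.refl) (yes ≡.refl) (no k≢) = criterion (bottomIndex (pivot i)) λ cs ds eq at-pivot → let open P cs ds eq in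
      all₃ (α≈0-from-bottom i j k cs at-pivot) (β≈0-of-k k≢ ≡.refl ≡.refl) (γ≈0-of-k k≢ ≡.refl ≡.refl)
    go (yes ≡.refl) (yes ≡.refl) (yes ≡.refl) = ⊥-elim (different ≡.refl)

  -- All additional planes together.

  Line : Set
  Line = (Fin q × Fin q × Fin q × Fin q) ⊎ (Fin (suc q) × Fin (suc q) × Fin q) ⊎ Fin 1

  plane : Line → Mat 3 7
  plane (inj₁ (x , y , z , d))     = skewPlane x y z d
  plane (inj₂ (inj₁ (i , j , k)))  = meetingPlane i j k
  plane (inj₂ (inj₂ 0F))           = axisPlane

  plane-LinIndep : ∀ l → LinIndep (plane l)
  plane-LinIndep (inj₁ (x , y , z , d)) = coordinates-LinIndep (skew-hasCoordinates x y z d) λ cs eq →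
    all₃ (eq 3F) (eq 4F) (eq 0F)
  plane-LinIndep (inj₂ (inj₁ (i , j , k))) = coordinates-LinIndep (meeting-hasCoordinates i j k) λ cs eq →
    all₃ (α≈0-from-bottom i j k cs (eq (bottomIndex (pivot i))))
         (β≈0-from-middle i j k cs (eq (middleIndex (pivot j))))
         (γ≈0-from-top i j k cs (eq (topIndex (pivot (i ⊕ j)))))
  plane-LinIndep (inj₂ (inj₂ 0F)) = coordinates-LinIndep axis-hasCoordinates λ cs eq →
    all₃ (eq 5F) (eq 6F) (eq 0F)

  lift-plane : ∀ A l → IntersectDimAtMost1 (lift A) (plane l)
  lift-plane A (inj₁ (x , y , z , d)) = lift-criterion A (skew-hasCoordinates x y z d) 0F
    λ cs γ≈0 → all₃ γ≈0 (*-zeroˡ γ≈0) (*-zeroˡ γ≈0)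
  lift-plane A (inj₂ (inj₁ (i , j , k))) =
    lift-criterion A (meeting-hasCoordinates i j k) (suc (pivot (i ⊕ j))) λ cs at-pivot →
      let γ≈0 = γ≈0-from-top i j k cs at-pivot
      in all₃ refl (*-zeroˡ γ≈0) (*-zeroˡ γ≈0)
  lift-plane A (inj₂ (inj₂ 0F)) = lift-criterion A axis-hasCoordinates 0F λ cs γ≈0 → all₃ γ≈0 refl refl

  plane-plane : ∀ l l′ → l ≢ l′ → IntersectDimAtMost1 (plane l) (plane l′)
  plane-plane (inj₁ (x , y , z , d)) (inj₁ (x′ , y′ , z′ , d′)) l≢l′ =
    skew-skew x y z d x′ y′ z′ d′ (l≢l′ ∘ ≡.cong inj₁)
  plane-plane (inj₁ (x , y , z , d)) (inj₂ (inj₁ (i , j , k))) _ = skew-meeting x y z d i j k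
  plane-plane (inj₁ (x , y , z , d)) (inj₂ (inj₂ 0F)) _ = skew-axis x y z d
  plane-plane (inj₂ (inj₁ (i , j , k))) (inj₁ (x , y , z , d)) _ =
    IntersectDimAtMost1-sym (skewPlane x y z d) (meetingPlane i j k) (skew-meeting x y z d i j k)
  plane-plane (inj₂ (inj₁ (i , j , k))) (inj₂ (inj₁ (i′ , j′ , k′))) l≢l′ =
    meeting-meeting i j k i′ j′ k′ (l≢l′ ∘ ≡.cong (inj₂ ∘ inj₁))
  plane-plane (inj₂ (inj₁ (i , j , k))) (inj₂ (inj₂ 0F)) _ = meeting-axis i j k
  plane-plane (inj₂ (inj₂ 0F)) (inj₁ (x , y , z , d)) _ =
    IntersectDimAtMost1-sym (skewPlane x y z d) axisPlane (skew-axis x y z d)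
  plane-plane (inj₂ (inj₂ 0F)) (inj₂ (inj₁ (i , j , k))) _ =
    IntersectDimAtMost1-sym (meetingPlane i j k) axisPlane (meeting-axis i j k)
  plane-plane (inj₂ (inj₂ 0F)) (inj₂ (inj₂ 0F)) l≢l′ = ⊥-elim (l≢l′ ≡.refl)

-- Counting the lines of S and assembling the code.

open import Data.Nat using (_+_; _*_; _^_)

-- The right-hand side is bracketed like the sums and products in `Line`, so that the standard
-- bijections for `Fin` apply summand by summand.
lineCount : ∀ q → q ^ 4 + q ^ 3 + 2 * q ^ 2 + q + 1 ≡
  q * (q * (q * q)) + (suc q * (suc q * q) + 1)
lineCount = solve 1 (λ q →
    q :^ 4 :+ q :^ 3 :+ con 2 :* q :^ 2 :+ q :+ con 1 :=
    q :* (q :* (q :* q)) :+ ((con 1 :+ q) :* ((con 1 :+ q) :* q) :+ con 1)) ≡.refl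
  where open ℕ-Solver.+-*-Solver

theorem3p2 : ∀ {c ℓ} (R : CommutativeRing c ℓ) → Lin.IsField R →
    (q : ℕ) → IsPrimePower q →
    Inverse (CommutativeRing.setoid R) (setoid (Fin q)) →
    (A : Fin (q ^ 8) → Lin.Mat R 3 4) →
    (∀ i j → ¬ (i ≡ j) → Lin.RankAtLeast R 2 (Lin._-ᴹ_ R (A i) (A j))) →
    Σ (Fin (q ^ 4 + q ^ 3 + 2 * q ^ 2 + q + 1) → Lin.Mat R 3 7) λ E →
    Lin.IsPlaneCodeFamily R ((λ i → Lin.lift R (A i)) ++ E)
theorem3p2 R isField q _ enumeration A A-rank =
  plane ∘ line , planeCodeFamily ((Lin.lift R ∘ A) ++ (plane ∘ line))
    (++-all (Lin.LinIndep R) (Lin.lift R ∘ A) (plane ∘ line)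
      (λ i → lift-LinIndep (A i)) (λ l → plane-LinIndep (line l)))
    (++-pairwise (Lin.IntersectDimAtMost1 R) (λ {M} {N} → IntersectDimAtMost1-sym M N)
      (Lin.lift R ∘ A) (plane ∘ line)
      (λ i j i≢j → lift-lift (A i) (A j) (A-rank i j i≢j))
      (λ i l → lift-plane (A i) (line l))
      (λ l l′ l≢l′ → plane-plane (line l) (line l′) (l≢l′ ∘ line-injective)))
  where
  open Inverse enumeration using (from; strictlyInverseˡ; to-cong)

  -- `from` lists the field elements and serves as `φ`; it has `to` as a left inverse.
  from-injective : ∀ {i j} → CommutativeRing._≈_ R (from i) (from j) → i ≡ j
  from-injective {i} {j} eq = ≡.trans (≡.sym (strictlyInverseˡ i)) (≡.trans (to-cong eq) (strictlyInverseˡ j))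

  open Subspaces R isField
  open Planes R isField q from from-injective

  lines : Fin (q ^ 4 + q ^ 3 + 2 * q ^ 2 + q + 1) ↔ Line
  lines = ↔-trans (≡⇒ (≡.cong Fin (lineCount q))) (↔-trans +↔⊎
    (↔-trans *↔× (↔-refl ×-↔ (↔-trans *↔× (↔-refl ×-↔ *↔×))) ⊎-↔
     ↔-trans +↔⊎ (↔-trans *↔× (↔-refl ×-↔ *↔×) ⊎-↔ ↔-refl)))

  line = Inverse.to lines

  line-injective : ∀ {l l′} → line l ≡ line l′ → l ≡ l′
  line-injective = Injection.injective (Inverse⇒Injection lines)
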